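{- Let $\mathcal{H}=\{rrb,bby,rby\}$. Then, as $n\to\infty$, $h_2(n,\mathcal{H})=\Theta(n^{2/3})$.
   Context: Edge-colorings of the complete graph $K_n$ use colors from $\{r,b,y\}$ (red, blue, yellow); they need not be proper, and not all colors need be used. A pattern is an edge-colored triangle, denoted by the multiset of the colors of its three edges; e.g. $rrb$ is the triangle with two red edges and one blue edge, $bby$ has two blue edges and one yellow edge, and $rby$ is the rainbow triangle with one edge of each color. For a family $\mathcal{H}$ of patterns, $\operatorname{Forb}(n,\mathcal{H})$ is the set of all edge-colorings of $K_n$ with colors from $\{r,b,y\}$ in which no triangle has a coloring belonging to $\mathcal{H}$. For an edge-coloring $c$ of $K_n$, $h_2(c)$ is the maximum $k$ such that there is a set of $k$ vertices whose induced edges use at most two of the three colors. Finally, $h_2(n,\mathcal{H})=\min\{h_2(c): c\in\operatorname{Forb}(n,\mathcal{H})\}$. -}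

module Defs where

open import Data.Nat using (ℕ; _≤_; _<_; _*_; _^_; NonZero)
open import Data.Fin using (Fin)
open import Data.Fin.Subset using (Subset; ∣_∣) renaming (_∈_ to _∈ₛ_)
open import Data.List using (List; []; _∷_)
open import Data.List.Relation.Unary.Any using (Any)
open import Data.List.Relation.Binary.Permutation.Propositional using (_↭_)
open import Data.Product using (_×_; ∃-syntax)
open import Data.Sum using (_⊎_)
open import Data.Vec using (Vec; []; _∷_; toList)
open import Relation.Binary.PropositionalEquality using (_≡_; _≢_)
open import Relation.Nullary using (¬_)

data Color : Set where
  r b y : Color

-- The values on the diagonal are junk: everything below reads `color u v`
-- only for u ≢ v.
record EdgeColoring (n : ℕ) : Set where
  field
    color     : Fin n → Fin n → Color
    color-sym : ∀ u v → color u v ≡ color v u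

open EdgeColoring public

-- Patterns are multisets of three colors, so they are compared up to
-- permutation by _≈ₚ_, never by _≡_.
Pattern : Set
Pattern = Vec Color 3

_≈ₚ_ : Pattern → Pattern → Set
p ≈ₚ q = toList p ↭ toList q

triangle : ∀ {n} → EdgeColoring n → (u v w : Fin n) → Pattern
triangle c u v w = color c u v ∷ color c v w ∷ color c u w ∷ []

Forb : (n : ℕ) → List Pattern → EdgeColoring n → Set
Forb n ℋ c = ∀ (u v w : Fin n) → u ≢ v → v ≢ w → u ≢ w →
  ¬ Any (triangle c u v w ≈ₚ_) ℋ

-- The colors i and j may coincide.
AtMostTwoColors : ∀ {n} → EdgeColoring n → Subset n → Set
AtMostTwoColors c S = ∃[ i ] ∃[ j ]
  (∀ u v → u ∈ₛ S → v ∈ₛ S → u ≢ v → color c u v ≡ i ⊎ color c u v ≡ j)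

IsMax IsMin : (ℕ → Set) → ℕ → Set
IsMax P k = P k × (∀ m → P m → m ≤ k)
IsMin P k = P k × (∀ m → P m → k ≤ m)

h₂[_]≡_ : ∀ {n} → EdgeColoring n → ℕ → Set
h₂[ c ]≡ k = IsMax (λ m → ∃[ S ] (∣ S ∣ ≡ m × AtMostTwoColors c S)) k

h₂[_,_]≡_ : ℕ → List Pattern → ℕ → Set
h₂[ n , ℋ ]≡ k = IsMin (λ m → ∃[ c ] (Forb n ℋ c × h₂[ c ]≡ m)) k

-- f(n) = Θ(n^(p/q)).  The constants are taken of the form 1/A and B with A, B
-- positive integers, which loses no generality, and the inequalities
--   (1/A) n^(p/q) ≤ f(n) ≤ B n^(p/q)
-- are raised to the q-th power to clear the fractional exponent.
IsΘ-n^_/_ : (p q : ℕ) .{{_ : NonZero q}} → (ℕ → ℕ) → Set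
(IsΘ-n^ p / q) f = ∃[ A ] ∃[ B ] ∃[ N ] (0 < A × 0 < B ×
  (∀ n → N ≤ n → n ^ p ≤ (A * f n) ^ q × f n ^ q ≤ B ^ q * n ^ p))

ℋ₀ : List Pattern
ℋ₀ = (r ∷ r ∷ b ∷ []) ∷ (b ∷ b ∷ y ∷ []) ∷ (r ∷ b ∷ y ∷ []) ∷ []

{-# OPTIONS --safe #-}
module Submission where

-- Lower bound.  Let every two-colored set have at most h vertices and t ~ √h.
-- The vertices without a blue edge span no blue, so there are at most h of them.
-- Among the vertices whose closed red neighborhood has fewer than t elements, a
-- maximal set spanning no red has at most h elements, and its closed red
-- neighborhoods cover, so there are at most h t of them.
-- Among the remaining vertices take a maximal set D spanning only yellow edges.
-- The closed red neighborhoods of D are disjoint and their union spans no blue,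
-- so |D| t ≤ h; the closed non-yellow neighborhood of a vertex with a blue edge
-- spans no yellow, and these cover, so at most |D| h ≤ h²/t vertices remain.
-- Altogether n = O(h^(3/2)).
--
-- Upper bound.  On triples (i, j, k) in [a]³ color an edge yellow if the i's
-- differ, else blue if the j's differ, else red.  A set missing one color is
-- determined by two of the coordinates, so it has at most a² vertices.
--
-- The minimum exists constructively because there are finitely many color
-- matrices and every property involved is decidable.

open import Data.Empty using (⊥; ⊥-elim)
open import Data.Fin as Fin using (Fin; zero; suc; inject≤; remQuot; combine)
open import Data.Fin.Properties as Fin using (all?; any?)
open import Data.Fin.Subset as Sub using (Subset; ∣_∣; _∪_; _─_; _⊆_; ⁅_⁆; inside; outside)
  renaming (_∈_ to _∈ₛ_; _∉_ to _∉ₛ_)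
import Data.Fin.Subset.Properties as Sub
open import Data.List using (List; []; _∷_; _++_)
open import Data.List.Membership.Propositional.Properties using (∈-∃++)
import Data.List.Membership.DecPropositional as DecMembership
import Data.List.Relation.Unary.Any as Any
open import Data.List.Relation.Unary.Any using (Any; here)
open import Data.List.Relation.Binary.Permutation.Propositional
  using (_↭_; ↭-refl; ↭-sym; ↭-trans; prep)
open import Data.List.Relation.Binary.Permutation.Propositional.Properties
  using (∈-resp-↭; shift; drop-∷; ¬x∷xs↭[])
open import Data.Nat
open import Data.Nat.Induction using (<-rec)
open import Data.Nat.Properties
open import Data.Nat.Tactic.RingSolver using (solve-∀)
open import Data.Product using (∃; ∃-syntax; _×_; _,_; uncurry; proj₁; proj₂)
open import Data.Sum using (_⊎_; inj₁; inj₂; [_,_]′)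
open import Data.Vec using (Vec; []; _∷_; here; there; lookup; tabulate; toList)
open import Data.Vec.Properties using (lookup∘tabulate; lookup⇒[]=; []=⇒lookup)
open import Function using (_∘_; id; case_of_)
open import Relation.Binary using (DecidableEquality; Reflexive; Symmetric)
import Relation.Binary as Binary
open import Relation.Binary.PropositionalEquality
open import Relation.Nullary using (¬_; Dec; yes; no; does; contradiction)
open import Relation.Nullary.Decidable
  using (map′; _×-dec_; _⊎-dec_; _→-dec_; ¬?; True; toWitness; dec-true; from-no; decidable-stable)
open import Relation.Unary using (Decidable)
-- With _,_ in scope, h₂[ n , ℋ ]≡ k would also parse as h₂[_]≡_ of a pair.
open import Defs renaming (h₂[_]≡_ to h₂⟨_⟩≡_)

private variable
  m n : ℕ

-- Counting in finite sets

∣p∪q∣≤∣p∣+∣q∣ : (p q : Subset n) → ∣ p ∪ q ∣ ≤ ∣ p ∣ + ∣ q ∣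
∣p∪q∣≤∣p∣+∣q∣ []            []            = z≤n
∣p∪q∣≤∣p∣+∣q∣ (outside ∷ p) (outside ∷ q) = ∣p∪q∣≤∣p∣+∣q∣ p q
∣p∪q∣≤∣p∣+∣q∣ (outside ∷ p) (inside  ∷ q) =
  ≤-trans (s≤s (∣p∪q∣≤∣p∣+∣q∣ p q)) (≤-reflexive (sym (+-suc ∣ p ∣ ∣ q ∣)))
∣p∪q∣≤∣p∣+∣q∣ (inside  ∷ p) (outside ∷ q) = s≤s (∣p∪q∣≤∣p∣+∣q∣ p q)
∣p∪q∣≤∣p∣+∣q∣ (inside  ∷ p) (inside  ∷ q) =
  s≤s (≤-trans (∣p∪q∣≤∣p∣+∣q∣ p q) (+-monoʳ-≤ ∣ p ∣ (n≤1+n ∣ q ∣)))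

x∈p─q⇒x∉q : (p q : Subset n) {x : Fin n} → x ∈ₛ p ─ q → x ∉ₛ q
x∈p─q⇒x∉q (_ ∷ p) (_ ∷ q) (there x∈p─q) (there x∈q) = x∈p─q⇒x∉q p q x∈p─q x∈q

∣p∣≤∣q∣+∣p─q∣ : (p q : Subset n) → ∣ p ∣ ≤ ∣ q ∣ + ∣ p ─ q ∣
∣p∣≤∣q∣+∣p─q∣ p q = ≤-trans (Sub.p⊆q⇒∣p∣≤∣q∣ split) (∣p∪q∣≤∣p∣+∣q∣ q (p ─ q))
  where
  split : p ⊆ q ∪ (p ─ q)
  split {x} x∈p with x Sub.∈? q
  ... | yes x∈q = Sub.x∈p∪q⁺ (inj₁ x∈q)
  ... | no  x∉q = Sub.x∈p∪q⁺ (inj₂ (Sub.x∈p∧x∉q⇒x∈p─q x∈p x∉q))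

∣q∣+∣p─q∣≤∣p∣ : (p q : Subset n) → q ⊆ p → ∣ q ∣ + ∣ p ─ q ∣ ≤ ∣ p ∣
∣q∣+∣p─q∣≤∣p∣ []            []            q⊆p = z≤n
∣q∣+∣p─q∣≤∣p∣ (outside ∷ p) (outside ∷ q) q⊆p = ∣q∣+∣p─q∣≤∣p∣ p q (Sub.drop-∷-⊆ q⊆p)
∣q∣+∣p─q∣≤∣p∣ (outside ∷ p) (inside  ∷ q) q⊆p with () ← q⊆p here
∣q∣+∣p─q∣≤∣p∣ (inside  ∷ p) (outside ∷ q) q⊆p =
  ≤-trans (≤-reflexive (+-suc ∣ q ∣ ∣ p ─ q ∣)) (s≤s (∣q∣+∣p─q∣≤∣p∣ p q (Sub.drop-∷-⊆ q⊆p)))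
∣q∣+∣p─q∣≤∣p∣ (inside  ∷ p) (inside  ∷ q) q⊆p = s≤s (∣q∣+∣p─q∣≤∣p∣ p q (Sub.drop-∷-⊆ q⊆p))

-- Induction along `D`: each member takes its set out of `A`, so what is left must be covered by the
-- sets of the later members.
covering-bound : ∀ {k} (A : Subset n) (D : Subset m) (R : Fin m → Subset n) →
  (∀ {v} → v ∈ₛ A → ∃[ u ] (u ∈ₛ D × v ∈ₛ R u)) →
  (∀ {u} → u ∈ₛ D → ∣ R u ∣ ≤ k) → ∣ A ∣ ≤ ∣ D ∣ * k
covering-bound {n = n} A [] R cover _ =
  ≤-trans (Sub.p⊆q⇒∣p∣≤∣q∣ {q = Sub.⊥ {n}} λ v∈A → case cover v∈A of λ ())
          (≤-reflexive (Sub.∣⊥∣≡0 n))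
covering-bound A (outside ∷ D) R cover R≤k =
  covering-bound A D (R ∘ suc) cover′ (R≤k ∘ there)
  where
  cover′ : ∀ {v} → v ∈ₛ A → ∃[ u ] (u ∈ₛ D × v ∈ₛ R (suc u))
  cover′ v∈A with cover v∈A
  ... | suc u , there u∈D , v∈R = u , u∈D , v∈R
covering-bound A (inside ∷ D) R cover R≤k =
  ≤-trans (∣p∣≤∣q∣+∣p─q∣ A (R zero))
          (+-mono-≤ (R≤k here) (covering-bound (A ─ R zero) D (R ∘ suc) cover′ (R≤k ∘ there)))
  where
  cover′ : ∀ {v} → v ∈ₛ A ─ R zero → ∃[ u ] (u ∈ₛ D × v ∈ₛ R (suc u))
  cover′ v∈A─R with cover (Sub.p─q⊆p A (R zero) v∈A─R)
  ... | suc u , there u∈D , v∈R = u , u∈D , v∈R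
  ... | zero  , here      , v∈R = contradiction v∈R (x∈p─q⇒x∉q A (R zero) v∈A─R)

-- The same removal read from below: disjointness keeps the later sets inside `A` once `R zero` is
-- taken out.
packing-bound : ∀ {t} (A : Subset n) (D : Subset m) (R : Fin m → Subset n) →
  (∀ {u} → u ∈ₛ D → t ≤ ∣ R u ∣) → (∀ {u} → u ∈ₛ D → R u ⊆ A) →
  (∀ {u u′ v} → u ∈ₛ D → u′ ∈ₛ D → v ∈ₛ R u → v ∈ₛ R u′ → u ≡ u′) → ∣ D ∣ * t ≤ ∣ A ∣
packing-bound A [] R _ _ _ = z≤n
packing-bound A (outside ∷ D) R t≤R R⊆A disjoint =
  packing-bound A D (R ∘ suc) (t≤R ∘ there) (R⊆A ∘ there)
    (λ p q x z → Fin.suc-injective (disjoint (there p) (there q) x z))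
packing-bound A (inside ∷ D) R t≤R R⊆A disjoint =
  ≤-trans (+-mono-≤ (t≤R here)
            (packing-bound (A ─ R zero) D (R ∘ suc) (t≤R ∘ there) R⊆A─R₀
              (λ p q x z → Fin.suc-injective (disjoint (there p) (there q) x z))))
          (∣q∣+∣p─q∣≤∣p∣ A (R zero) (R⊆A here))
  where
  R⊆A─R₀ : ∀ {u} → u ∈ₛ D → R (suc u) ⊆ A ─ R zero
  R⊆A─R₀ u∈D v∈R = Sub.x∈p∧x∉q⇒x∈p─q (R⊆A (there u∈D) v∈R)
    λ v∈R₀ → case disjoint here (there u∈D) v∈R₀ v∈R of λ ()

-- The singletons `⁅ f u ⁆` are packed into the codomain; injectivity makes them disjoint.
pigeonhole : (A : Subset n) (f : Fin n → Fin m) →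
  (∀ {u v} → u ∈ₛ A → v ∈ₛ A → f u ≡ f v → u ≡ v) → ∣ A ∣ ≤ m
pigeonhole {m = m} A f injective = begin
  ∣ A ∣         ≡⟨ *-identityʳ ∣ A ∣ ⟨
  ∣ A ∣ * 1     ≤⟨ packing-bound Sub.⊤ A (⁅_⁆ ∘ f) (λ {u} _ → ≤-reflexive (sym (Sub.∣⁅x⁆∣≡1 (f u))))
                     (λ _ _ → Sub.∈⊤)
                     (λ {u} {u′} p q x z → injective p q
                       (trans (sym (Sub.x∈⁅y⁆⇒x≡y (f u) x)) (Sub.x∈⁅y⁆⇒x≡y (f u′) z))) ⟩
  ∣ Sub.⊤ {m} ∣ ≡⟨ Sub.∣⊤∣≡n m ⟩
  m             ∎
  where open ≤-Reasoning

⟦_⟧ : {P : Fin n → Set} → Decidable P → Subset n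
⟦ P? ⟧ = tabulate (does ∘ P?)

module _ {P : Fin n → Set} (P? : Decidable P) where

  ∈⟦⟧⁺ : ∀ {v} → P v → v ∈ₛ ⟦ P? ⟧
  ∈⟦⟧⁺ {v} Pv = lookup⇒[]= v ⟦ P? ⟧ (trans (lookup∘tabulate _ v) (dec-true (P? v) Pv))

  ∈⟦⟧⁻ : ∀ {v} → v ∈ₛ ⟦ P? ⟧ → P v
  ∈⟦⟧⁻ {v} v∈ with P? v | trans (sym (lookup∘tabulate (does ∘ P?) v)) ([]=⇒lookup v∈)
  ... | yes Pv | _ = Pv

-- Greedy choice, one index at a time: an element of `A` joins `D` unless one already chosen is
-- related to it. Reflexivity lets the members of `D` cover themselves.
maximal-independent : {E : Fin n → Fin n → Set} → Reflexive E → Symmetric E → Binary.Decidable E →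
  (A : Subset n) → ∃[ D ] (D ⊆ A
    × (∀ {u v} → u ∈ₛ D → v ∈ₛ D → u ≢ v → ¬ E u v)
    × (∀ {v} → v ∈ₛ A → ∃[ u ] (u ∈ₛ D × E u v)))
maximal-independent E-refl E-sym E? [] = [] , id , (λ ()) , λ ()
maximal-independent {suc n} {E} E-refl E-sym E? (a ∷ A)
  with maximal-independent E-refl E-sym (λ u v → E? (suc u) (suc v)) A
... | D , D⊆A , indep , maximal = extend a (any? λ u → (u Sub.∈? D) ×-dec E? (suc u) zero)
  where
  indep-outside : ∀ {u v} → u ∈ₛ outside ∷ D → v ∈ₛ outside ∷ D → u ≢ v → ¬ E u v
  indep-outside (there p) (there q) u≢v = indep p q (u≢v ∘ cong suc)

  extend : ∀ a → Dec (∃[ u ] (u ∈ₛ D × E (suc u) zero)) → ∃[ D′ ] (D′ ⊆ a ∷ A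
    × (∀ {u v} → u ∈ₛ D′ → v ∈ₛ D′ → u ≢ v → ¬ E u v)
    × (∀ {v} → v ∈ₛ a ∷ A → ∃[ u ] (u ∈ₛ D′ × E u v)))
  extend outside _ = outside ∷ D , (λ { (there p) → there (D⊆A p) }) , indep-outside ,
    λ { (there p) → let u , q , e = maximal p in suc u , there q , e }
  extend inside (yes (w , w∈D , e)) =
    outside ∷ D , (λ { (there p) → there (D⊆A p) }) , indep-outside ,
    λ { here      → suc w , there w∈D , e
      ; (there p) → let u , q , e = maximal p in suc u , there q , e }
  extend inside (no free) = inside ∷ D , (λ { here → here ; (there p) → there (D⊆A p) }) ,
    (λ { here      here      u≢v → contradiction refl u≢v
       ; here      (there q) _ e → free (_ , q , E-sym e)
       ; (there p) here      _ e → free (_ , p , e)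
       ; (there p) (there q) u≢v → indep p q (u≢v ∘ cong suc) }) ,
    λ { here      → zero , here , E-refl
      ; (there p) → let u , q , e = maximal p in suc u , there q , e }

-- Finite search

greatest : {P : ℕ → Set} → Decidable P → ∀ N → (∀ m → P m → m ≤ N) → ∃ P → ∃ (IsMax P)
greatest P? zero    bound (m , Pm) = m , Pm , λ k Pk → ≤-trans (bound k Pk) z≤n
greatest P? (suc N) bound P∃ with P? (suc N)
... | yes PN = suc N , PN , bound
... | no ¬PN = greatest P? N
  (λ m Pm → ≤-pred (≤∧≢⇒< (bound m Pm) λ { refl → ¬PN Pm })) P∃

least : {P : ℕ → Set} → Decidable P → ∃ P → ∃ (IsMin P)
least {P} P? (m , Pm) = <-rec (λ m → P m → ∃ (IsMin P)) step m Pm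
  where
  step : ∀ m → (∀ {k} → k < m → P k → ∃ (IsMin P)) → P m → ∃ (IsMin P)
  step m rec Pm with anyUpTo? P? m
  ... | yes (k , k<m , Pk) = rec k<m Pk
  ... | no  minimal        = m , Pm , λ k Pk → ≮⇒≥ λ k<m → minimal (k , k<m , Pk)

Searchable : Set → Set₁
Searchable A = {P : A → Set} → Decidable P → Dec (∃ P)

Vec-searchable : ∀ {A} → Searchable A → ∀ n → Searchable (Vec A n)
Vec-searchable search zero P? = map′ ([] ,_) (λ { ([] , p) → p }) (P? [])
Vec-searchable search (suc n) P? =
  map′ (λ (x , xs , p) → x ∷ xs , p) (λ { (x ∷ xs , p) → x , xs , p })
       (search λ x → Vec-searchable search n λ xs → P? (x ∷ xs))

Color-searchable : Searchable Color
Color-searchable P? = map′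
  (λ { (inj₁ p) → r , p ; (inj₂ (inj₁ p)) → b , p ; (inj₂ (inj₂ p)) → y , p })
  (λ { (r , p) → inj₁ p ; (b , p) → inj₂ (inj₁ p) ; (y , p) → inj₂ (inj₂ p) })
  (P? r ⊎-dec P? b ⊎-dec P? y)

-- Deciding whether a pattern is forbidden.

infix 4 _≟ᶜ_
_≟ᶜ_ : DecidableEquality Color
r ≟ᶜ r = yes refl
r ≟ᶜ b = no λ ()
r ≟ᶜ y = no λ ()
b ≟ᶜ r = no λ ()
b ≟ᶜ b = yes refl
b ≟ᶜ y = no λ ()
y ≟ᶜ r = no λ ()
y ≟ᶜ b = no λ ()
y ≟ᶜ y = yes refl

module _ {A : Set} (_≟_ : DecidableEquality A) where
  open DecMembership _≟_ using (_∈?_)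

  -- The head of the first list is located in the second, moved to the front by `shift` and
  -- cancelled.
  ↭-dec : (xs ys : List A) → Dec (xs ↭ ys)
  ↭-dec [] []       = yes ↭-refl
  ↭-dec [] (z ∷ zs) = no λ p → ¬x∷xs↭[] (↭-sym p)
  ↭-dec (x ∷ xs) ys with x ∈? ys
  ... | no x∉ys = no λ p → x∉ys (∈-resp-↭ p (here refl))
  ... | yes x∈ys with ∈-∃++ x∈ys
  ...   | as , bs , refl = map′
    (λ p → ↭-trans (prep x p) (↭-sym (shift x as bs)))
    (λ p → drop-∷ (↭-trans p (shift x as bs)))
    (↭-dec xs (as ++ bs))

Forbidden : Pattern → Set
Forbidden p = Any (p ≈ₚ_) ℋ₀

forbidden? : Decidable Forbidden
forbidden? p = Any.any? (λ q → ↭-dec _≟ᶜ_ (toList p) (toList q)) ℋ₀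

-- The structure of colorings in Forb n ℋ₀

r≢b : r ≢ b
r≢b ()

r≢y : r ≢ y
r≢y ()

b≢y : b ≢ y
b≢y ()

other-two : (k : Color) → ∃[ i ] ∃[ j ] ({x : Color} → x ≢ k → x ≡ i ⊎ x ≡ j)
other-two r = b , y , λ { {r} x≢k → contradiction refl x≢k ; {b} _ → inj₁ refl ; {y} _ → inj₂ refl }
other-two b = r , y , λ { {r} _ → inj₁ refl ; {b} x≢k → contradiction refl x≢k ; {y} _ → inj₂ refl }
other-two y = r , b , λ { {r} _ → inj₁ refl ; {b} _ → inj₂ refl ; {y} x≢k → contradiction refl x≢k }

missing-third : (i j : Color) → ∃[ k ] (k ≢ i × k ≢ j)
missing-third r r = b , (λ ()) , λ ()
missing-third r b = y , (λ ()) , λ ()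
missing-third r y = b , (λ ()) , λ ()
missing-third b r = y , (λ ()) , λ ()
missing-third b b = r , (λ ()) , λ ()
missing-third b y = r , (λ ()) , λ ()
missing-third y r = b , (λ ()) , λ ()
missing-third y b = r , (λ ()) , λ ()
missing-third y y = r , (λ ()) , λ ()

-- Working form of `AtMostTwoColors`, naming the absent color; the next two lemmas convert between
-- them.
Avoids : EdgeColoring n → Color → Subset n → Set
Avoids c k S = ∀ {u v} → u ∈ₛ S → v ∈ₛ S → u ≢ v → color c u v ≢ k

avoids⇒atMostTwo : (c : EdgeColoring n) → ∀ {k S} → Avoids c k S → AtMostTwoColors c S
avoids⇒atMostTwo c {k} avoids =
  let i , j , other = other-two k in i , j , λ u v p q u≢v → other (avoids p q u≢v)

atMostTwo⇒avoids : (c : EdgeColoring n) → ∀ {S} → AtMostTwoColors c S → ∃[ k ] Avoids c k S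
atMostTwo⇒avoids c (i , j , two) =
  let k , k≢i , k≢j = missing-third i j in
  k , λ {u} {v} p q u≢v c≡k →
    [ k≢i ∘ trans (sym c≡k) , k≢j ∘ trans (sym c≡k) ]′ (two u v p q u≢v)

-- Lower bound: transfer of blue along red edges, and three vertex classes.

module LowerBound (c : EdgeColoring n) (forb : Forb n ℋ₀ c)
  {h : ℕ} (bound : ∀ S → AtMostTwoColors c S → ∣ S ∣ ≤ h) where

  bounded : ∀ {k S} → Avoids c k S → ∣ S ∣ ≤ h
  bounded {S = S} avoids = bound S (avoids⇒atMostTwo c avoids)

  -- For concrete colors the implicit `True` argument is found by computation, so a use need only
  -- supply the three edges, in any order of the pattern.
  forbids : ∀ {u v w i j k} → u ≢ v → v ≢ w → u ≢ w →
    color c u v ≡ i → color c v w ≡ j → color c u w ≡ k →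
    {True (forbidden? (i ∷ j ∷ k ∷ []))} → ⊥
  forbids {u} {v} {w} u≢v v≢w u≢w refl refl refl {t} = forb u v w u≢v v≢w u≢w (toWitness t)

  flip-color : ∀ {u v k} → color c u v ≡ k → color c v u ≡ k
  flip-color {u} {v} = trans (color-sym c v u)

  HasBlue : Fin n → Set
  HasBlue v = ∃[ z ] (v ≢ z × color c v z ≡ b)

  hasBlue? : Decidable HasBlue
  hasBlue? v = any? λ z → ¬? (v Fin.≟ z) ×-dec (color c v z ≟ᶜ b)

  Red⁼ NonYellow⁼ : Fin n → Fin n → Set
  Red⁼       u v = u ≡ v ⊎ color c u v ≡ r
  NonYellow⁼ u v = u ≡ v ⊎ color c u v ≢ y

  red⁼? : Binary.Decidable Red⁼
  red⁼? u v = (u Fin.≟ v) ⊎-dec (color c u v ≟ᶜ r)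

  nonYellow⁼? : Binary.Decidable NonYellow⁼
  nonYellow⁼? u v = (u Fin.≟ v) ⊎-dec ¬? (color c u v ≟ᶜ y)

  red⁼-sym : Symmetric Red⁼
  red⁼-sym (inj₁ u≡v) = inj₁ (sym u≡v)
  red⁼-sym (inj₂ red) = inj₂ (flip-color red)

  nonYellow⁼-sym : Symmetric NonYellow⁼
  nonYellow⁼-sym (inj₁ u≡v) = inj₁ (sym u≡v)
  nonYellow⁼-sym (inj₂ ≢y)  = inj₂ (≢y ∘ flip-color)

  red⁼⇒nonYellow⁼ : ∀ {u v} → Red⁼ u v → NonYellow⁼ u v
  red⁼⇒nonYellow⁼ (inj₁ u≡v) = inj₁ u≡v
  red⁼⇒nonYellow⁼ (inj₂ red) = inj₂ (r≢y ∘ trans (sym red))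

  -- If uv is red and vz is blue, a red uz would give rrb and a yellow one rby. This transfer of
  -- blue along red edges drives the whole lower bound.
  red⁼-blue : ∀ {u v z} → Red⁼ u v → u ≢ z → v ≢ z → color c v z ≡ b → color c u z ≡ b
  red⁼-blue (inj₁ refl) _ _ blue = blue
  red⁼-blue {u} {v} {z} (inj₂ red) u≢z v≢z blue with color c u z in eq
  ... | b = refl
  ... | r = ⊥-elim (forbids u≢v v≢z u≢z red blue eq)
    -- The diagonal may carry the color red, so `u ≢ v` is obtained from the different colors of uz
    -- and vz.
    where u≢v = λ { refl → r≢b (trans (sym eq) blue) }
  ... | y = ⊥-elim (forbids u≢v v≢z u≢z red blue eq)
    where u≢v = λ { refl → b≢y (trans (sym blue) eq) }

  -- A blue vw would pass along the red uv and make uw blue, though it is red. The coincidences of u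
  -- with v or w are treated apart.
  red⁼-not-blue : ∀ {u v w} → Red⁼ u v → Red⁼ u w → v ≢ w → color c v w ≢ b
  red⁼-not-blue (inj₁ refl) (inj₁ refl) v≢w _ = v≢w refl
  red⁼-not-blue (inj₁ refl) (inj₂ red)  _ blue = r≢b (trans (sym red) blue)
  red⁼-not-blue {u} {v} {w} u~v (inj₂ red) v≢w blue with u Fin.≟ w
  ... | no u≢w = r≢b (trans (sym red) (red⁼-blue u~v u≢w v≢w blue))
  ... | yes refl = [ v≢w ∘ sym , (λ red → r≢b (trans (sym red) (flip-color blue))) ]′ u~v
  red⁼-not-blue (inj₂ red) (inj₁ refl) _ blue = r≢b (trans (sym red) (flip-color blue))

  -- When vu and vw are both red, a blue edge vz forces uz and wz to be blue, so
  -- a yellow uw would close a triangle bby.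
  nonYellow-trans : ∀ {u v w} → HasBlue v → v ≢ u → v ≢ w → u ≢ w →
    color c v u ≢ y → color c v w ≢ y → color c u w ≢ y
  nonYellow-trans {u} {v} {w} (z , v≢z , vz) v≢u v≢w u≢w vu≢y vw≢y uw
    with color c v u in vu | color c v w in vw
  ... | y | _ = vu≢y refl
  ... | _ | y = vw≢y refl
  ... | b | b = forbids (v≢u ∘ sym) v≢w u≢w (flip-color vu) vw uw
  ... | b | r = forbids (v≢u ∘ sym) v≢w u≢w (flip-color vu) vw uw
  ... | r | b = forbids (v≢u ∘ sym) v≢w u≢w (flip-color vu) vw uw
  ... | r | r = forbids u≢z (w≢z ∘ sym) u≢w
                  (red⁼-blue (inj₂ (flip-color vu)) u≢z v≢z vz)
                  (flip-color (red⁼-blue (inj₂ (flip-color vw)) w≢z v≢z vz)) uw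
    where
    u≢z : u ≢ z
    u≢z refl = r≢b (trans (sym vu) vz)
    w≢z : w ≢ z
    w≢z refl = r≢b (trans (sym vw) vz)

  -- The blue edge is asked of the common vertex v. This serves both with v as the center of one
  -- neighborhood and with v as a point shared by two.
  nonYellow⁼-trans : ∀ {u v w} → HasBlue v → NonYellow⁼ v u → NonYellow⁼ v w → NonYellow⁼ u w
  nonYellow⁼-trans _ (inj₁ refl) v~w = v~w
  nonYellow⁼-trans _ v~u (inj₁ refl) = nonYellow⁼-sym v~u
  nonYellow⁼-trans {u} {v} {w} blue (inj₂ vu) (inj₂ vw) with u Fin.≟ w | v Fin.≟ u | v Fin.≟ w
  ... | yes u≡w | _        | _        = inj₁ u≡w
  ... | no _    | yes refl | _        = inj₂ vw
  ... | no _    | no _     | yes refl = nonYellow⁼-sym (inj₂ vu)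
  ... | no u≢w  | no v≢u   | no v≢w   = inj₂ (nonYellow-trans blue v≢u v≢w u≢w vu vw)

  -- Lets a point of a closed red neighborhood play the middle vertex in `nonYellow⁼-trans`.
  hasBlue-red⁼ : ∀ {u v} → HasBlue u → Red⁼ u v → HasBlue v
  hasBlue-red⁼ blue (inj₁ refl) = blue
  hasBlue-red⁼ {u} {v} (z , u≢z , uz) (inj₂ red) =
    z , v≢z , red⁼-blue (inj₂ (flip-color red)) v≢z u≢z uz
    where
    v≢z : v ≢ z
    v≢z refl = r≢b (trans (sym red) uz)

  redNbhd nonYellowNbhd : Fin n → Subset n
  redNbhd       u = ⟦ red⁼? u ⟧
  nonYellowNbhd u = ⟦ nonYellow⁼? u ⟧

  blueless : Subset n
  blueless = ⟦ ¬? ∘ hasBlue? ⟧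

  ∣blueless∣≤h : ∣ blueless ∣ ≤ h
  ∣blueless∣≤h = bounded {b} λ {_} {v} p _ u≢v uv → ∈⟦⟧⁻ (¬? ∘ hasBlue?) p (v , u≢v , uv)

  module _ (t : ℕ) where

    small? : Decidable λ v → ∣ redNbhd v ∣ < t
    small? v = ∣ redNbhd v ∣ <? t

    large? : Decidable λ v → HasBlue v × t ≤ ∣ redNbhd v ∣
    large? v = hasBlue? v ×-dec (t ≤? ∣ redNbhd v ∣)

    small large : Subset n
    small = ⟦ small? ⟧
    large = ⟦ large? ⟧

    ∣small∣≤h*t : ∣ small ∣ ≤ h * t
    ∣small∣≤h*t with maximal-independent (inj₁ refl) red⁼-sym red⁼? small
    ... | D , D⊆small , indep , maximal = ≤-trans
      (covering-bound small D redNbhd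
        (λ v∈ → let u , u∈D , u~v = maximal v∈ in u , u∈D , ∈⟦⟧⁺ (red⁼? u) u~v)
        (λ u∈D → <⇒≤ (∈⟦⟧⁻ small? (D⊆small u∈D))))
      (*-monoˡ-≤ t (bounded {r} λ p q u≢v red → indep p q u≢v (inj₂ red)))

    -- Product of two estimates on `D`: the closed non-yellow neighborhoods cover, so
    -- `∣ large ∣ ≤ ∣ D ∣ * h`, and the closed red ones pack into `U`, so `∣ D ∣ * t ≤ h`.
    ∣large∣*t≤h*h : ∣ large ∣ * t ≤ h * h
    ∣large∣*t≤h*h with maximal-independent (inj₁ refl) nonYellow⁼-sym nonYellow⁼? large
    ... | D , D⊆large , indep , maximal = begin
      ∣ large ∣ * t   ≤⟨ *-monoˡ-≤ t ∣large∣≤∣D∣*h ⟩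
      ∣ D ∣ * h * t   ≡⟨ swap ∣ D ∣ h t ⟩
      ∣ D ∣ * t * h   ≤⟨ *-monoˡ-≤ h (≤-trans ∣D∣*t≤∣U∣ (bounded {b} U-not-blue)) ⟩
      h * h           ∎
      where
      open ≤-Reasoning

      swap : ∀ d h t → d * h * t ≡ d * t * h
      swap = solve-∀

      D-hasBlue : ∀ {u} → u ∈ₛ D → HasBlue u
      D-hasBlue u∈D = proj₁ (∈⟦⟧⁻ large? (D⊆large u∈D))

      ∣large∣≤∣D∣*h : ∣ large ∣ ≤ ∣ D ∣ * h
      ∣large∣≤∣D∣*h = covering-bound large D nonYellowNbhd
        (λ v∈ → let u , u∈D , u~v = maximal v∈ in u , u∈D , ∈⟦⟧⁺ (nonYellow⁼? u) u~v)
        (λ {u} u∈D → bounded {y} λ p q v≢w vw →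
          [ v≢w , (λ ≢y → ≢y vw) ]′ (nonYellow⁼-trans (D-hasBlue u∈D)
            (∈⟦⟧⁻ (nonYellow⁼? u) p) (∈⟦⟧⁻ (nonYellow⁼? u) q)))

      inU? : Decidable λ v → ∃[ u ] (u ∈ₛ D × Red⁼ u v)
      inU? v = any? λ u → (u Sub.∈? D) ×-dec red⁼? u v

      U : Subset n
      U = ⟦ inU? ⟧

      -- Between neighborhoods of different centers, a blue vv′ passes along red edges first to uv′
      -- and then to uu′, but distinct members of `D` are joined by yellow.
      U-not-blue : Avoids c b U
      U-not-blue {v} {v′} p q v≢v′ blue with ∈⟦⟧⁻ inU? p | ∈⟦⟧⁻ inU? q
      ... | u , u∈D , u~v | u′ , u′∈D , u′~v′ with u Fin.≟ u′
      ...   | yes refl = red⁼-not-blue u~v u′~v′ v≢v′ blue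
      ...   | no  u≢u′ = indep u∈D u′∈D u≢u′ (inj₂ λ yellow → b≢y (trans (sym u-u′) yellow))
        where
        u≢v′ : u ≢ v′
        u≢v′ refl = indep u′∈D u∈D (u≢u′ ∘ sym) (red⁼⇒nonYellow⁼ u′~v′)
        u-v′ : color c u v′ ≡ b
        u-v′ = red⁼-blue u~v u≢v′ v≢v′ blue
        u-u′ : color c u u′ ≡ b
        u-u′ = flip-color (red⁼-blue u′~v′ (u≢u′ ∘ sym) (u≢v′ ∘ sym) (flip-color u-v′))

      ∣D∣*t≤∣U∣ : ∣ D ∣ * t ≤ ∣ U ∣
      ∣D∣*t≤∣U∣ = packing-bound U D redNbhd
        (λ u∈D → proj₂ (∈⟦⟧⁻ large? (D⊆large u∈D)))
        (λ {u} u∈D v∈R → ∈⟦⟧⁺ inU? (u , u∈D , ∈⟦⟧⁻ (red⁼? u) v∈R))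
        disjoint
        where
        -- A shared vertex inherits a blue edge from u, so `nonYellow⁼-trans` at that vertex would
        -- relate two distinct members of `D`.
        disjoint : ∀ {u u′ v} → u ∈ₛ D → u′ ∈ₛ D → v ∈ₛ redNbhd u → v ∈ₛ redNbhd u′ → u ≡ u′
        disjoint {u} {u′} p p′ q q′ with u Fin.≟ u′ | ∈⟦⟧⁻ (red⁼? u) q | ∈⟦⟧⁻ (red⁼? u′) q′
        ... | yes u≡u′ | _   | _    = u≡u′
        ... | no u≢u′  | u~v | u′~v = contradiction
          (nonYellow⁼-trans (hasBlue-red⁼ (D-hasBlue p) u~v)
            (red⁼⇒nonYellow⁼ (red⁼-sym u~v)) (red⁼⇒nonYellow⁼ (red⁼-sym u′~v)))
          (indep p p′ u≢u′)

    n≤sum : n ≤ h + (h * t + ∣ large ∣)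
    n≤sum = begin
      n                                     ≡⟨ Sub.∣⊤∣≡n n ⟨
      ∣ Sub.⊤ {n} ∣                         ≤⟨ Sub.p⊆q⇒∣p∣≤∣q∣ split ⟩
      ∣ blueless ∪ (small ∪ large) ∣        ≤⟨ ∣p∪q∣≤∣p∣+∣q∣ blueless (small ∪ large) ⟩
      ∣ blueless ∣ + ∣ small ∪ large ∣      ≤⟨ +-mono-≤ ∣blueless∣≤h (∣p∪q∣≤∣p∣+∣q∣ small large) ⟩
      h + (∣ small ∣ + ∣ large ∣)           ≤⟨ +-monoʳ-≤ h (+-monoˡ-≤ ∣ large ∣ ∣small∣≤h*t) ⟩
      h + (h * t + ∣ large ∣)               ∎
      where
      open ≤-Reasoning
      split : Sub.⊤ ⊆ blueless ∪ (small ∪ large)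
      split {v} _ with hasBlue? v | t ≤? ∣ redNbhd v ∣
      ... | no ¬blue | _      = Sub.x∈p∪q⁺ (inj₁ (∈⟦⟧⁺ (¬? ∘ hasBlue?) ¬blue))
      ... | yes blue | yes t≤ = Sub.x∈p∪q⁺ (inj₂ (Sub.x∈p∪q⁺ (inj₂ (∈⟦⟧⁺ large? (blue , t≤)))))
      ... | yes _    | no t≰  = Sub.x∈p∪q⁺ (inj₂ (Sub.x∈p∪q⁺ (inj₁ (∈⟦⟧⁺ small? (≰⇒> t≰)))))

-- Colorings with small two-colored sets

-- An injection into the triples suffices, which accommodates every n up to a³.
module UpperBound {a : ℕ} (digits : Fin n → Fin a × Fin a × Fin a)
  (digits-injective : ∀ {u v} → digits u ≡ digits v → u ≡ v) where

  block clique place : Fin n → Fin a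
  block = proj₁ ∘ digits
  clique = proj₁ ∘ proj₂ ∘ digits
  place = proj₂ ∘ proj₂ ∘ digits

  -- The coloring as a relation, so that matching on a color also yields the coordinate conditions
  -- behind it.
  data Joined (u v : Fin n) : Color → Set where
    red    : block u ≡ block v → clique u ≡ clique v → Joined u v r
    blue   : block u ≡ block v → clique u ≢ clique v → Joined u v b
    yellow : block u ≢ block v → Joined u v y

  joined : ∀ u v → ∃ (Joined u v)
  joined u v with block u Fin.≟ block v | clique u Fin.≟ clique v
  ... | yes i≡ | yes j≡ = r , red i≡ j≡
  ... | yes i≡ | no  j≢ = b , blue i≡ j≢
  ... | no  i≢ | _      = y , yellow i≢

  joined-sym : ∀ {u v k} → Joined u v k → Joined v u k
  joined-sym (red i≡ j≡)  = red (sym i≡) (sym j≡)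
  joined-sym (blue i≡ j≢) = blue (sym i≡) (j≢ ∘ sym)
  joined-sym (yellow i≢)  = yellow (i≢ ∘ sym)

  joined-unique : ∀ {u v k l} → Joined u v k → Joined u v l → k ≡ l
  joined-unique (red _ _)    (red _ _)    = refl
  joined-unique (red _ j≡)   (blue _ j≢)  = contradiction j≡ j≢
  joined-unique (red i≡ _)   (yellow i≢)  = contradiction i≡ i≢
  joined-unique (blue _ j≢)  (red _ j≡)   = contradiction j≡ j≢
  joined-unique (blue _ _)   (blue _ _)   = refl
  joined-unique (blue i≡ _)  (yellow i≢)  = contradiction i≡ i≢
  joined-unique (yellow i≢)  (red i≡ _)   = contradiction i≡ i≢
  joined-unique (yellow i≢)  (blue i≡ _)  = contradiction i≡ i≢
  joined-unique (yellow _)   (yellow _)   = refl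

  coloring : EdgeColoring n
  coloring .color u v = proj₁ (joined u v)
  coloring .color-sym u v =
    joined-unique (proj₂ (joined u v)) (joined-sym (proj₂ (joined v u)))

  color≡ : ∀ {u v k} → Joined u v k → color coloring u v ≡ k
  color≡ {u} {v} = joined-unique (proj₂ (joined u v))

  -- Equality of coordinates is transitive, which excludes the inconsistent combinations; the
  -- remaining patterns are checked by computation.
  allowed : ∀ {u v w i j k} → Joined u v i → Joined v w j → Joined u w k →
    ¬ Forbidden (i ∷ j ∷ k ∷ [])
  allowed (red p q)  (red p′ q′)  (red _ _)   = from-no (forbidden? (r ∷ r ∷ r ∷ []))
  allowed (red p q)  (red p′ q′)  (blue _ j≢) = contradiction (trans q q′) j≢
  allowed (red p q)  (red p′ q′)  (yellow i≢) = contradiction (trans p p′) i≢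
  allowed (red p q)  (blue p′ q′) (red _ j≡)  = contradiction (trans (sym q) j≡) q′
  allowed (red p q)  (blue p′ q′) (blue _ _)  = from-no (forbidden? (r ∷ b ∷ b ∷ []))
  allowed (red p q)  (blue p′ q′) (yellow i≢) = contradiction (trans p p′) i≢
  allowed (red p q)  (yellow p′)  (red i≡ _)  = contradiction (trans (sym p) i≡) p′
  allowed (red p q)  (yellow p′)  (blue i≡ _) = contradiction (trans (sym p) i≡) p′
  allowed (red p q)  (yellow p′)  (yellow _)  = from-no (forbidden? (r ∷ y ∷ y ∷ []))
  allowed (blue p q) (red p′ q′)  (red _ j≡)  = contradiction (trans j≡ (sym q′)) q
  allowed (blue p q) (red p′ q′)  (blue _ _)  = from-no (forbidden? (b ∷ r ∷ b ∷ []))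
  allowed (blue p q) (red p′ q′)  (yellow i≢) = contradiction (trans p p′) i≢
  allowed (blue p q) (blue p′ q′) (red _ _)   = from-no (forbidden? (b ∷ b ∷ r ∷ []))
  allowed (blue p q) (blue p′ q′) (blue _ _)  = from-no (forbidden? (b ∷ b ∷ b ∷ []))
  allowed (blue p q) (blue p′ q′) (yellow i≢) = contradiction (trans p p′) i≢
  allowed (blue p q) (yellow p′)  (red i≡ _)  = contradiction (trans (sym p) i≡) p′
  allowed (blue p q) (yellow p′)  (blue i≡ _) = contradiction (trans (sym p) i≡) p′
  allowed (blue p q) (yellow p′)  (yellow _)  = from-no (forbidden? (b ∷ y ∷ y ∷ []))
  allowed (yellow p) (red p′ q′)  (red i≡ _)  = contradiction (trans i≡ (sym p′)) p
  allowed (yellow p) (red p′ q′)  (blue i≡ _) = contradiction (trans i≡ (sym p′)) p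
  allowed (yellow p) (red p′ q′)  (yellow _)  = from-no (forbidden? (y ∷ r ∷ y ∷ []))
  allowed (yellow p) (blue p′ q′) (red i≡ _)  = contradiction (trans i≡ (sym p′)) p
  allowed (yellow p) (blue p′ q′) (blue i≡ _) = contradiction (trans i≡ (sym p′)) p
  allowed (yellow p) (blue p′ q′) (yellow _)  = from-no (forbidden? (y ∷ b ∷ y ∷ []))
  allowed (yellow p) (yellow p′)  (red _ _)   = from-no (forbidden? (y ∷ y ∷ r ∷ []))
  allowed (yellow p) (yellow p′)  (blue _ _)  = from-no (forbidden? (y ∷ y ∷ b ∷ []))
  allowed (yellow p) (yellow p′)  (yellow _)  = from-no (forbidden? (y ∷ y ∷ y ∷ []))

  coloring-Forb : Forb n ℋ₀ coloring
  coloring-Forb u v w _ _ _ =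
    allowed (proj₂ (joined u v)) (proj₂ (joined v w)) (proj₂ (joined u w))

  -- The two coordinates kept are those whose agreement leaves distinct vertices only the absent
  -- color: differing in the third coordinate, they would be joined by it.
  ∣S∣≤a*a : ∀ S → AtMostTwoColors coloring S → ∣ S ∣ ≤ a * a
  ∣S∣≤a*a S two with atMostTwo⇒avoids coloring two
  ... | r , avoids = pigeonhole S (λ u → combine (block u) (clique u)) λ {u} {v} p q eq →
    let i≡ , j≡ = Fin.combine-injective (block u) (clique u) (block v) (clique v) eq in
    decidable-stable (u Fin.≟ v) λ u≢v → avoids p q u≢v (color≡ (red i≡ j≡))
  ... | b , avoids = pigeonhole S (λ u → combine (block u) (place u)) λ {u} {v} p q eq →
    let i≡ , k≡ = Fin.combine-injective (block u) (place u) (block v) (place v) eq in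
    decidable-stable (u Fin.≟ v) λ u≢v → case clique u Fin.≟ clique v of λ
      { (yes j≡) → u≢v (digits-injective (cong₂ _,_ i≡ (cong₂ _,_ j≡ k≡)))
      ; (no j≢)  → avoids p q u≢v (color≡ (blue i≡ j≢)) }
  ... | y , avoids = pigeonhole S (λ u → combine (clique u) (place u)) λ {u} {v} p q eq →
    let j≡ , k≡ = Fin.combine-injective (clique u) (place u) (clique v) (place v) eq in
    decidable-stable (u Fin.≟ v) λ u≢v → case block u Fin.≟ block v of λ
      { (yes i≡) → u≢v (digits-injective (cong₂ _,_ i≡ (cong₂ _,_ j≡ k≡)))
      ; (no i≢)  → avoids p q u≢v (color≡ (yellow i≢)) }

remQuot-injective : ∀ k {i j : Fin (m * k)} → remQuot {m} k i ≡ remQuot k j → i ≡ j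
remQuot-injective {m} k {i} {j} eq = begin
  i                                   ≡⟨ Fin.combine-remQuot {m} k i ⟨
  uncurry combine (remQuot {m} k i)   ≡⟨ cong (uncurry combine) eq ⟩
  uncurry combine (remQuot {m} k j)   ≡⟨ Fin.combine-remQuot {m} k j ⟩
  j                                   ∎
  where open ≡-Reasoning

digits : ∀ a → Fin (a * (a * a)) → Fin a × Fin a × Fin a
digits a u = let i , jk = remQuot {a} (a * a) u in i , remQuot a jk

digits-injective : ∀ a {u v : Fin (a * (a * a))} → digits a u ≡ digits a v → u ≡ v
digits-injective a eq =
  remQuot-injective {a} (a * a) (cong₂ _,_ (cong proj₁ eq) (remQuot-injective {a} a (cong proj₂ eq)))

forb-coloring-with-small-sets : ∀ {a} → n ≤ a * (a * a) →
  ∃[ c ] (Forb n ℋ₀ c × (∀ S → AtMostTwoColors c S → ∣ S ∣ ≤ a * a))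
forb-coloring-with-small-sets {a = a} n≤a³ = U.coloring , U.coloring-Forb , U.∣S∣≤a*a
  where
  module U = UpperBound (λ u → digits a (inject≤ u n≤a³))
    (Fin.inject≤-injective n≤a³ n≤a³ _ _ ∘ digits-injective a)

-- Existence of the minimum

infix 4 _≈ᶜ_
-- A coloring rebuilt from its matrix agrees with the original only pointwise, so the properties
-- searched for are transported along this relation.
_≈ᶜ_ : EdgeColoring n → EdgeColoring n → Set
c ≈ᶜ d = ∀ u v → color c u v ≡ color d u v

Forb-resp-≈ᶜ : ∀ {ℋ} {c d : EdgeColoring n} → c ≈ᶜ d → Forb n ℋ c → Forb n ℋ d
Forb-resp-≈ᶜ {ℋ = ℋ} {c} {d} c≈d forb u v w u≢v v≢w u≢w =
  forb u v w u≢v v≢w u≢w ∘ subst (λ p → Any (p ≈ₚ_) ℋ) (sym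
    (cong₂ _∷_ (c≈d u v) (cong₂ _∷_ (c≈d v w) (cong (_∷ []) (c≈d u w)))))

AtMostTwo-resp-≈ᶜ : ∀ {c d : EdgeColoring n} {S} → c ≈ᶜ d → AtMostTwoColors c S → AtMostTwoColors d S
AtMostTwo-resp-≈ᶜ c≈d (i , j , two) =
  i , j , λ u v p q u≢v → subst (λ x → x ≡ i ⊎ x ≡ j) (c≈d u v) (two u v p q u≢v)

h₂-resp-≈ᶜ : ∀ {c d : EdgeColoring n} {k} → c ≈ᶜ d → h₂⟨ c ⟩≡ k → h₂⟨ d ⟩≡ k
h₂-resp-≈ᶜ {c = c} {d} c≈d ((S , ∣S∣≡k , two) , max) =
  (S , ∣S∣≡k , AtMostTwo-resp-≈ᶜ {c = c} {d} c≈d two) ,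
  λ m (S , ∣S∣≡m , two) → max m (S , ∣S∣≡m , AtMostTwo-resp-≈ᶜ {c = d} {c} (λ u v → sym (c≈d u v)) two)

IsMax-unique : ∀ {P j k} → IsMax P j → IsMax P k → j ≡ k
IsMax-unique (Pj , maxⱼ) (Pk , maxₖ) = ≤-antisym (maxₖ _ Pj) (maxⱼ _ Pk)

atMostTwoColors? : (c : EdgeColoring n) → Decidable (AtMostTwoColors c)
atMostTwoColors? c S = Color-searchable λ i → Color-searchable λ j →
  all? λ u → all? λ v → (u Sub.∈? S) →-dec ((v Sub.∈? S) →-dec
    (¬? (u Fin.≟ v) →-dec ((color c u v ≟ᶜ i) ⊎-dec (color c u v ≟ᶜ j))))

forb? : Decidable (Forb n ℋ₀)
forb? c = all? λ u → all? λ v → all? λ w → ¬? (u Fin.≟ v) →-dec (¬? (v Fin.≟ w) →-dec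
  (¬? (u Fin.≟ w) →-dec ¬? (forbidden? (triangle c u v w))))

∃h₂ : (c : EdgeColoring n) → ∃ (h₂⟨ c ⟩≡_)
∃h₂ {n} c = greatest
  (λ m → Sub.anySubset? λ S → (∣ S ∣ ≟ m) ×-dec atMostTwoColors? c S)
  n
  (λ { m (S , refl , _) → Sub.∣p∣≤n S })
  -- The empty set is vacuously two-colored, so some size is attained.
  (0 , Sub.⊥ , Sub.∣⊥∣≡0 n , r , r , λ _ _ u∈⊥ → contradiction u∈⊥ Sub.∉⊥)

h₂? : (c : EdgeColoring n) → Decidable (h₂⟨ c ⟩≡_)
h₂? c m = let k , isMax = ∃h₂ c in
  map′ (λ { refl → isMax }) (IsMax-unique isMax) (k ≟ m)

-- Finite data representing a coloring, within reach of `Vec-searchable`.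
Matrix : ℕ → Set
Matrix n = Vec (Vec Color n) n

entry : Matrix n → Fin n → Fin n → Color
entry M u v = lookup (lookup M u) v

fromMatrix : (M : Matrix n) → (∀ u v → entry M u v ≡ entry M v u) → EdgeColoring n
fromMatrix M M-sym = record { color = entry M ; color-sym = M-sym }

toMatrix : EdgeColoring n → Matrix n
toMatrix c = tabulate λ u → tabulate (color c u)

entry-toMatrix : (c : EdgeColoring n) → ∀ u v → color c u v ≡ entry (toMatrix c) u v
entry-toMatrix c u v = sym (trans
  (cong (λ row → lookup row v) (lookup∘tabulate (λ u → tabulate (color c u)) u))
  (lookup∘tabulate (color c u) v))

attained? : ∀ n → Decidable (λ m → ∃[ c ] (Forb n ℋ₀ c × h₂⟨ c ⟩≡ m))
attained? n m = map′
  (λ (M , M-sym , p) → fromMatrix M M-sym , p)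
  (λ (c , forb , isMax) →
    let M = toMatrix c
        M-sym u v = trans (sym (entry-toMatrix c u v)) (trans (color-sym c u v) (entry-toMatrix c v u))
        d = fromMatrix M M-sym
    in M , M-sym , Forb-resp-≈ᶜ {c = c} {d} (entry-toMatrix c) forb ,
       h₂-resp-≈ᶜ {c = c} {d} (entry-toMatrix c) isMax)
  (Vec-searchable (Vec-searchable Color-searchable n) n symmetric-attained?)
  where
  symmetric-attained? : Decidable λ M →
    ∃[ M-sym ] (Forb n ℋ₀ (fromMatrix M M-sym) × h₂⟨ fromMatrix M M-sym ⟩≡ m)
  symmetric-attained? M with all? (λ u → all? (λ v → entry M u v ≟ᶜ entry M v u))
  ... | no ¬sym   = no (¬sym ∘ proj₁)
  -- Both properties unfold to statements about `color` alone, so they hold definitionally for every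
  -- choice of symmetry proof.
  ... | yes M-sym = map′ (M-sym ,_) proj₂
    (forb? (fromMatrix M M-sym) ×-dec h₂? (fromMatrix M M-sym) m)

monochromatic : EdgeColoring n
monochromatic = record { color = λ _ _ → r ; color-sym = λ _ _ → refl }

∃h₂-min : ∀ n → ∃ (h₂[ n , ℋ₀ ]≡_)
∃h₂-min n = least (attained? n) (let k , isMax = ∃h₂ monochromatic in
  -- The all-red coloring shows that the minimum is over a nonempty set.
  k , monochromatic , (λ _ _ _ _ _ _ → from-no (forbidden? (r ∷ r ∷ r ∷ []))) , isMax)

-- Estimates

-- The floor of the k-th root. Passing to n + 1 raises it by at most one, since n < (s+1)^k gives n
-- + 1 ≤ (s+1)^k < (s+2)^k.
∃root : ∀ k .{{_ : NonZero k}} n → ∃[ s ] (s ^ k ≤ n × n < suc s ^ k)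
∃root k@(suc _) zero = 0 , z≤n , ≤-reflexive (sym (^-zeroˡ k))
∃root k (suc n) with ∃root k n
... | s , s^k≤n , n<s₁^k with suc n <? suc s ^ k
...   | yes sn< = s , m≤n⇒m≤1+n s^k≤n , sn<
...   | no  sn≮ = suc s , ≮⇒≥ sn≮ , ≤-<-trans n<s₁^k (^-monoˡ-< k (n<1+n (suc s)))

suc-≤-double : ∀ {s} → 0 < s → suc s ≤ 2 * s
suc-≤-double {s} 0<s = ≤-trans (+-monoˡ-≤ s 0<s) (+-monoʳ-≤ s (≤-reflexive (sym (+-identityʳ s))))

0<root : ∀ {k n s} → .{{_ : NonZero k}} → 0 < n → n < suc s ^ k → 0 < s
0<root {k} {s = zero}  0<n n<1 = contradiction (<-≤-trans n<1 (≤-reflexive (^-zeroˡ k))) (≤⇒≯ 0<n)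
0<root     {s = suc _} _   _   = z<s

-- After multiplication by t each of the three summands is at most h t²; the factor t is then
-- cancelled, which avoids division.
n≤3ht : ∀ {n h t l} .{{_ : NonZero t}} →
  n ≤ h + (h * t + l) → l * t ≤ h * h → h ≤ t ^ 2 → n ≤ 3 * (h * t)
n≤3ht {n} {h} {t} {l} n≤sum lt≤h² h≤t² = *-cancelʳ-≤ n (3 * (h * t)) t (begin
  n * t                               ≤⟨ *-monoˡ-≤ t n≤sum ⟩
  (h + (h * t + l)) * t               ≡⟨ expand h t l ⟩
  h * t + h * t * t + l * t           ≤⟨ +-mono-≤ (+-monoˡ-≤ (h * t * t) (m≤m*n (h * t) t))
                                           (≤-trans lt≤h² (*-monoʳ-≤ h h≤t²)) ⟩
  h * t * t + h * t * t + h * t ^ 2   ≡⟨ collect h t ⟩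
  3 * (h * t) * t                     ∎)
  where
  open ≤-Reasoning

  expand : ∀ h t l → (h + (h * t + l)) * t ≡ h * t + h * t * t + l * t
  expand = solve-∀

  -- In the identities proved by solve-∀, which does not handle _^_, the powers
  -- are written out.
  collect : ∀ h t → h * t * t + h * t * t + h * (t * (t * 1)) ≡ 3 * (h * t) * t
  collect = solve-∀

n²≤64h³ : ∀ {n h t} → n ≤ 3 * (h * t) → t ^ 2 ≤ 4 * h → n ^ 2 ≤ (4 * h) ^ 3
n²≤64h³ {n} {h} {t} n≤3ht t²≤4h = begin
  n ^ 2                       ≤⟨ ^-monoˡ-≤ 2 n≤3ht ⟩
  (3 * (h * t)) ^ 2           ≡⟨ square h t ⟩
  -- Rounding 9 up to 16 turns the final constant into the cube 64 = 4³.
  9 * (h * h) * t ^ 2         ≤⟨ *-mono-≤ (*-monoˡ-≤ (h * h) (m≤m+n 9 7)) t²≤4h ⟩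
  16 * (h * h) * (4 * h)      ≡⟨ cube h ⟩
  (4 * h) ^ 3                 ∎
  where
  open ≤-Reasoning

  square : ∀ h t → let u = 3 * (h * t) in u * (u * 1) ≡ 9 * (h * h) * (t * (t * 1))
  square = solve-∀

  cube : ∀ h → 16 * (h * h) * (4 * h) ≡ 4 * h * (4 * h * (4 * h * 1))
  cube = solve-∀

t²≤4h : ∀ {h s t} → t ≤ 2 * s → s ^ 2 ≤ h → t ^ 2 ≤ 4 * h
t²≤4h {h} {s} {t} t≤2s s²≤h = begin
  t ^ 2         ≤⟨ ^-monoˡ-≤ 2 t≤2s ⟩
  (2 * s) ^ 2   ≡⟨ square s ⟩
  4 * s ^ 2     ≤⟨ *-monoʳ-≤ 4 s²≤h ⟩
  4 * h         ∎
  where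
  open ≤-Reasoning

  square : ∀ s → 2 * s * (2 * s * 1) ≡ 4 * (s * (s * 1))
  square = solve-∀

k³≤64n² : ∀ {k n a s} → k ≤ a * a → a ≤ 2 * s → s ^ 3 ≤ n → k ^ 3 ≤ 4 ^ 3 * n ^ 2
k³≤64n² {k} {n} {a} {s} k≤a² a≤2s s³≤n = begin
  k ^ 3                     ≤⟨ ^-monoˡ-≤ 3 (≤-trans k≤a² (*-mono-≤ a≤2s a≤2s)) ⟩
  (2 * s * (2 * s)) ^ 3     ≡⟨ expand s ⟩
  64 * (s ^ 3) ^ 2          ≤⟨ *-monoʳ-≤ 64 (^-monoˡ-≤ 2 s³≤n) ⟩
  64 * n ^ 2                ∎
  where
  open ≤-Reasoning

  expand : ∀ s → let u = 2 * s * (2 * s) ; v = s * (s * (s * 1)) in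
    u * (u * (u * 1)) ≡ 64 * (v * (v * 1))
  expand = solve-∀

-- The two bounds and the order of magnitude.

lower-bound : ∀ n {h} → h₂[ n , ℋ₀ ]≡ h → n ^ 2 ≤ (4 * h) ^ 3
lower-bound n {h} ((c , forb , _ , max) , _) = case 0 <? h of λ
  -- With s the floor of √h, t = s + 1 satisfies h ≤ t² and, as s > 0, t ≤ 2s. This balances h t
  -- against h²/t.
  { (yes 0<h) → let s , s²≤h , h<t² = ∃root 2 h ; t = suc s in
      n²≤64h³ {h = h} {t} (n≤3ht {t = t} (n≤sum t) (∣large∣*t≤h*h t) (<⇒≤ h<t²))
        (t²≤4h {s = s} {t} (suc-≤-double (0<root {2} 0<h h<t²)) s²≤h)
  -- For h = 0 the root is 0 and t ≤ 2s fails; here the class estimates at t = 1 force n = 0.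
  ; (no 0≮h) → n²≤64h³ {h = h} {0}
      (n≤3h*0 (n≤0⇒n≡0 (≮⇒≥ 0≮h))) z≤n }
  where
  open LowerBound c forb (λ S two → max ∣ S ∣ (S , refl , two))

  n≤3h*0 : h ≡ 0 → n ≤ 3 * (h * 0)
  n≤3h*0 refl = ≤-trans (n≤sum 1)
    (≤-trans (≤-reflexive (sym (*-identityʳ _))) (∣large∣*t≤h*h 1))

-- The side a is one more than the floor of the cube root of n, so n ≤ a³, and a is at most twice
-- that floor because n > 0.
upper-bound : ∀ {n h} → 0 < n → h₂[ n , ℋ₀ ]≡ h → h ^ 3 ≤ 4 ^ 3 * n ^ 2
upper-bound {n} {h} 0<n (_ , min) =
  let s , s³≤n , n<a³ = ∃root 3 n
      c , forb , small-sets = forb-coloring-with-small-sets {a = suc s} (n≤a*a*a (suc s) (<⇒≤ n<a³))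
      l , isMax@((S , ∣S∣≡l , two) , _) = ∃h₂ c
      h≤a*a = ≤-trans (min l (c , forb , isMax))
                (≤-trans (≤-reflexive (sym ∣S∣≡l)) (small-sets S two))
  in k³≤64n² {a = suc s} {s} h≤a*a (suc-≤-double (0<root {3} 0<n n<a³)) s³≤n
  where
  n≤a*a*a : ∀ a → n ≤ a ^ 3 → n ≤ a * (a * a)
  n≤a*a*a a = subst (λ x → n ≤ a * (a * x)) (*-identityʳ a)

lemma3p7 : ∃[ h ] ((∀ (n : ℕ) → h₂[ n , ℋ₀ ]≡ (h n)) × (IsΘ-n^ 2 / 3) h)
lemma3p7 = proj₁ ∘ ∃h₂-min , proj₂ ∘ ∃h₂-min ,
  -- A = B = 4, both from 64 = 4³; the threshold 1 supplies the positivity in `upper-bound`.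
  4 , 4 , 1 , z<s , z<s , λ n 0<n →
    lower-bound n (proj₂ (∃h₂-min n)) , upper-bound 0<n (proj₂ (∃h₂-min n))
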